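{- Let $G$ be a graph on $n\ge1$ vertices. Then $D(G,k)$, as a function of the positive integer $k$, is given by a polynomial in $k$ (with rational coefficients) of degree $n$ and with constant term $0$. If $G$ has no non-trivial automorphisms, then $D(G,k)=k^n$; otherwise, the sum of the coefficients of this polynomial is $0$.
   Context: A $k$-labeling of $G$ is a map $\phi:V(G)\to\{1,\dots,k\}$; an automorphism $\pi$ preserves $\phi$ if $\phi(\pi(v))=\phi(v)$ for all $v$; $\phi$ is distinguishing if only the identity preserves it. Two distinguishing $k$-labelings $\phi,\phi'$ are equivalent if some automorphism $\pi$ satisfies $\phi'(\pi(v))=\phi(v)$ for all $v$; $D(G,k)$ is the number of equivalence classes of distinguishing $k$-labelings of $G$. -}

module Defs where

open import Data.Fin.Base using (Fin; zero; suc; finToFun; funToFin)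
open import Data.Fin.Permutation as Perm using (Permutation′; _⟨$⟩ʳ_; _⟨$⟩ˡ_; _∘ₚ_)
open import Data.Fin.Properties using (_≟_; any?; all?; finToFun-funToFin)
open import Data.Integer.Base using (+_)
open import Data.List.Base using (List; []; _∷_; length; lookup; map; filter; deduplicate; allFin; foldr)
open import Data.List.Membership.Propositional.Properties using (∈-allFin; ∈-lookup)
import Data.List.Membership.Setoid as Membershipₛ
import Data.List.Membership.Setoid.Properties as Membershipₛₚ
import Data.List.Relation.Unary.All as All
import Data.List.Relation.Unary.All.Properties as Allₚ
import Data.List.Relation.Unary.Any as Any
import Data.List.Relation.Unary.Any.Properties as Anyₚ
open import Data.List.Relation.Unary.AllPairs using (AllPairs; []; _∷_)
open import Data.List.Relation.Unary.Unique.DecSetoid.Properties using (deduplicate-!)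
open import Data.Nat.Base using (ℕ; zero; suc; _^_; _<_)
open import Data.Product.Base using (Σ; ∃-syntax; _×_; _,_; proj₁)
open import Data.Rational.Base using (ℚ; 0ℚ; _+_; _*_; _/_)
open import Function.Base using (_∘_; _on_)
open import Function.Bundles using (_⇔_; mk⇔; Bijection; Equivalence)
open import Level using (0ℓ)
open import Relation.Binary.Bundles using (Setoid; DecSetoid)
open import Relation.Binary.Core using (Rel)
open import Relation.Binary.Definitions using (Decidable; Symmetric; Irreflexive)
open import Relation.Binary.PropositionalEquality using (_≡_; _≢_; _≗_; refl; sym; trans; cong; subst₂; setoid)
open import Relation.Nullary using (¬_; Dec)
open import Relation.Nullary.Decidable using (map′; _×-dec_; _→-dec_; ¬?; decidable-stable)
open import Relation.Nullary.Negation using (contradiction)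

record Graph (n : ℕ) : Set₁ where
  field
    Adj        : Rel (Fin n) 0ℓ
    adj?       : Decidable Adj
    adj-sym    : Symmetric Adj
    adj-irrefl : Irreflexive _≡_ Adj

Labeling : ℕ → ℕ → Set
Labeling n k = Fin n → Fin k

module _ {n : ℕ} (G : Graph n) where

  open Graph G using (Adj; adj?)

  PreservesAdj : (Fin n → Fin n) → Set
  PreservesAdj f = ∀ u v → Adj u v ⇔ Adj (f u) (f v)

  record Automorphism : Set where
    constructor mkAut
    field
      perm      : Permutation′ n
      preserves : PreservesAdj (perm ⟨$⟩ʳ_)

  open Automorphism public

  apply : Automorphism → Fin n → Fin n
  apply π = perm π ⟨$⟩ʳ_

  IsTrivial : Automorphism → Set
  IsTrivial π = ∀ v → apply π v ≡ v

  HasNonTrivialAutomorphism : Set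
  HasNonTrivialAutomorphism = ∃[ π ] ¬ IsTrivial π

  PreservesLabeling : {k : ℕ} → Automorphism → Labeling n k → Set
  PreservesLabeling π φ = ∀ v → φ (apply π v) ≡ φ v

  Distinguishing : {k : ℕ} → Labeling n k → Set
  Distinguishing φ = ∀ π → PreservesLabeling π φ → IsTrivial π

  Equivalent : {k : ℕ} → Rel (Labeling n k) 0ℓ
  Equivalent φ φ′ = ∃[ π ] (∀ v → φ′ (apply π v) ≡ φ v)

  idAut : Automorphism
  idAut = mkAut Perm.id (λ u v → mk⇔ (λ a → a) (λ a → a))

  invAut : Automorphism → Automorphism
  invAut (mkAut π p) = mkAut (Perm.flip π) λ u v →
    let e = p (π ⟨$⟩ˡ u) (π ⟨$⟩ˡ v)
    in mk⇔ (λ a → Equivalence.from e (subst₂ Adj (sym (Perm.inverseʳ π)) (sym (Perm.inverseʳ π)) a))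
           (λ a → subst₂ Adj (Perm.inverseʳ π) (Perm.inverseʳ π) (Equivalence.to e a))

  -- Diagrammatic order, as for _∘ₚ_.
  compAut : Automorphism → Automorphism → Automorphism
  compAut (mkAut π p) (mkAut ρ q) = mkAut (π ∘ₚ ρ) λ u v →
    mk⇔ (Equivalence.to (q _ _) ∘ Equivalence.to (p u v))
        (Equivalence.from (p u v) ∘ Equivalence.from (q _ _))

  ≗⇒equivalent : ∀ {k} {φ ψ : Labeling n k} → φ ≗ ψ → Equivalent φ ψ
  ≗⇒equivalent eq = idAut , λ v → sym (eq v)

  equivalent-sym : ∀ {k} {φ ψ : Labeling n k} → Equivalent φ ψ → Equivalent ψ φ
  equivalent-sym {φ = φ} {ψ} (π , e) = invAut π , λ v →
    trans (sym (e (perm π ⟨$⟩ˡ v))) (cong ψ (Perm.inverseʳ (perm π)))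

  equivalent-trans : ∀ {k} {φ ψ χ : Labeling n k} → Equivalent φ ψ → Equivalent ψ χ → Equivalent φ χ
  equivalent-trans (π , e) (ρ , f) = compAut π ρ , λ v → trans (f (apply π v)) (e v)

  distinguishing-resp : ∀ {k} {φ ψ : Labeling n k} → Equivalent φ ψ → Distinguishing φ → Distinguishing ψ
  distinguishing-resp {φ = φ} {ψ} (π , e) d ρ pr v = fixed
    where
    σ : Automorphism
    σ = compAut π (compAut ρ (invAut π))
    fixes : PreservesLabeling σ φ
    fixes w = trans (sym (e (apply σ w)))
              (trans (cong ψ (Perm.inverseʳ (perm π))) (trans (pr (apply π w)) (e w)))
    w₀ : Fin n
    w₀ = perm π ⟨$⟩ˡ v
    fixed : apply ρ v ≡ v
    fixed =
      trans (cong (apply ρ) (sym (Perm.inverseʳ (perm π))))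
      (trans (sym (Perm.inverseʳ (perm π)))
      (trans (cong (apply π) (d σ fixes w₀)) (Perm.inverseʳ (perm π))))

  -- Exhaustive search over pairs of mutually inverse maps, each coded by an
  -- element of Fin (n ^ n).
  anyAut? : {P : (Fin n → Fin n) → Set} →
            (∀ {f g} → f ≗ g → P f → P g) →
            (∀ f → Dec (P f)) →
            Dec (∃[ π ] P (apply π))
  anyAut? {P} resp P? = map′ to from
    (any? λ i → any? λ j → code? (finToFun i) (finToFun j))
    where
    Code : (f g : Fin n → Fin n) → Set
    Code f g = ((∀ v → f (g v) ≡ v) × (∀ v → g (f v) ≡ v)) × PreservesAdj f × P f

    code? : ∀ f g → Dec (Code f g)
    code? f g = ((all? λ v → f (g v) ≟ v) ×-dec (all? λ v → g (f v) ≟ v))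
      ×-dec (all? λ u → all? λ v → map′ (λ (a , b) → mk⇔ a b)
               (λ e → Equivalence.to e , Equivalence.from e)
               ((adj? u v →-dec adj? (f u) (f v)) ×-dec (adj? (f u) (f v) →-dec adj? u v)))
      ×-dec P? f

    to : ∃[ i ] ∃[ j ] Code (finToFun i) (finToFun j) → ∃[ π ] P (apply π)
    to (i , j , (l , r) , p , q) = mkAut (Perm.permutation (finToFun i) (finToFun j) l r) p , q

    from : ∃[ π ] P (apply π) → ∃[ i ] ∃[ j ] Code (finToFun i) (finToFun j)
    from (mkAut π p , q) = funToFin f , funToFin g ,
      ( (λ v → trans (cong F (eg v)) (trans (ef (g v)) (Perm.inverseʳ π)))
      , (λ v → trans (cong K (ef v)) (trans (eg (f v)) (Perm.inverseˡ π)))) ,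
      (λ u v → mk⇔
        (λ a → subst₂ Adj (sym (ef u)) (sym (ef v)) (Equivalence.to (p u v) a))
        (λ a → Equivalence.from (p u v) (subst₂ Adj (ef u) (ef v) a))) ,
      resp (λ v → sym (ef v)) q
      where
      f g F K : Fin n → Fin n
      f = π ⟨$⟩ʳ_
      g = π ⟨$⟩ˡ_
      F = finToFun (funToFin f)
      K = finToFun (funToFin g)
      ef : F ≗ f
      ef = finToFun-funToFin f
      eg : K ≗ g
      eg = finToFun-funToFin g

  equivalent? : {k : ℕ} → Decidable (Equivalent {k})
  equivalent? φ φ′ = anyAut?
    (λ eq e v → trans (cong φ′ (sym (eq v))) (e v))
    (λ f → all? λ v → φ′ (f v) ≟ φ v)

  distinguishing? : {k : ℕ} (φ : Labeling n k) → Dec (Distinguishing φ)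
  distinguishing? φ = map′
    (λ none π pr → decidable-stable (all? λ v → apply π v ≟ v) (λ nt → none (π , pr , nt)))
    (λ d (π , pr , nt) → nt (d π pr))
    (¬? (anyAut?
      (λ eq (pr , nt) → (λ v → trans (cong φ (sym (eq v))) (pr v))
                      , (λ t → nt (λ v → trans (eq v) (t v))))
      (λ f → (all? λ v → φ (f v) ≟ φ v) ×-dec ¬? (all? λ v → f v ≟ v))))

  labelingDecSetoid : ℕ → DecSetoid 0ℓ 0ℓ
  labelingDecSetoid k = record
    { Carrier = Labeling n k
    ; _≈_ = Equivalent
    ; isDecEquivalence = record
      { isEquivalence = record
        { refl = ≗⇒equivalent (λ _ → refl) ; sym = equivalent-sym ; trans = λ {_} {_} {χ} → equivalent-trans {χ = χ} }
      ; _≟_ = equivalent?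
      }
    }

  distinguishingSetoid : ℕ → Setoid 0ℓ 0ℓ
  distinguishingSetoid k = record
    { Carrier = Σ (Labeling n k) Distinguishing
    ; _≈_ = Equivalent on proj₁
    ; isEquivalence = record
      { refl = ≗⇒equivalent (λ _ → refl) ; sym = equivalent-sym ; trans = λ {_} {_} {χ} → equivalent-trans {χ = proj₁ χ} }
    }

allLabelings : (n k : ℕ) → List (Labeling n k)
allLabelings n k = map finToFun (allFin (k ^ n))

classRepresentatives : {n : ℕ} → Graph n → (k : ℕ) → List (Labeling n k)
classRepresentatives {n} G k =
  deduplicate (equivalent? G) (filter (distinguishing? G) (allLabelings n k))

D : {n : ℕ} → Graph n → ℕ → ℕ
D G k = length (classRepresentatives G k)

-- D G k is the cardinality of the set of distinguishing k-labelings modulo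
-- equivalence.
D-counts : {n : ℕ} (G : Graph n) (k : ℕ) →
           Bijection (setoid (Fin (D G k))) (distinguishingSetoid G k)
D-counts {n} G k = record
  { to = rep
  ; cong = λ { refl → S.refl }
  ; bijective = (λ {i} {j} → lookup-injective _ unique i j) , surjective
  }
  where
  module S = DecSetoid (labelingDecSetoid G k)
  open Membershipₛ S.setoid using (_∈_)

  reps : List (Labeling n k)
  reps = classRepresentatives G k

  candidates : List (Labeling n k)
  candidates = filter (distinguishing? G) (allLabelings n k)

  unique : AllPairs (λ φ ψ → ¬ Equivalent G φ ψ) reps
  unique = deduplicate-! (labelingDecSetoid G k) candidates

  rep : Fin (D G k) → Σ (Labeling n k) (Distinguishing G)
  rep i = lookup reps i , All.lookup
    (Allₚ.deduplicate⁺ (equivalent? G) (Allₚ.all-filter (distinguishing? G) (allLabelings n k)))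
    (∈-lookup i)

  lookup-injective : (xs : List (Labeling n k)) → AllPairs (λ φ ψ → ¬ Equivalent G φ ψ) xs →
                     ∀ i j → Equivalent G (lookup xs i) (lookup xs j) → i ≡ j
  lookup-injective (x ∷ xs) (p ∷ ps) zero    zero    e = refl
  lookup-injective (x ∷ xs) (p ∷ ps) zero    (suc j) e = contradiction e (All.lookup p (∈-lookup j))
  lookup-injective (x ∷ xs) (p ∷ ps) (suc i) zero    e =
    contradiction (S.sym e) (All.lookup p (∈-lookup i))
  lookup-injective (x ∷ xs) (p ∷ ps) (suc i) (suc j) e = cong suc (lookup-injective xs ps i j e)

  complete : (φ : Labeling n k) → Distinguishing G φ → φ ∈ reps
  complete φ d = Membershipₛₚ.∈-deduplicate⁺ S.setoid (equivalent? G)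
    (λ {φ₁} {φ₂} {φ₃} e f → S.trans {φ₁} {φ₂} {φ₃} f (S.sym {φ₃} {φ₂} e))
    (Membershipₛₚ.∈-filter⁺ S.setoid (distinguishing? G) (distinguishing-resp G)
      (Anyₚ.map⁺ (Any.map (λ { refl → ≗⇒equivalent G (λ v → sym (finToFun-funToFin φ v)) })
        (∈-allFin (funToFin φ))))
      d)

  surjective : ∀ y → ∃[ i ] (∀ {j} → j ≡ i → Equivalent G (proj₁ (rep j)) (proj₁ y))
  surjective (φ , d) = Any.index φ∈ , λ { refl → S.sym (Anyₚ.lookup-index φ∈) }
    where
    φ∈ : φ ∈ reps
    φ∈ = complete φ d

-- A polynomial over ℚ is its list of coefficients, constant term first;
-- trailing zeros are allowed.
Polynomial : Set
Polynomial = List ℚ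

coeff : Polynomial → ℕ → ℚ
coeff []      _       = 0ℚ
coeff (a ∷ p) zero    = a
coeff (a ∷ p) (suc i) = coeff p i

eval : Polynomial → ℚ → ℚ
eval p x = foldr (λ a r → a + x * r) 0ℚ p

HasDegree : Polynomial → ℕ → Set
HasDegree p d = coeff p d ≢ 0ℚ × (∀ i → d < i → coeff p i ≡ 0ℚ)

coeffSum : Polynomial → ℚ
coeffSum = foldr _+_ 0ℚ

ℕ→ℚ : ℕ → ℚ
ℕ→ℚ m = + m / 1

{-# OPTIONS --safe #-}
module Submission where

-- Equivalent labelings use the same set of colours, so sorting the classes by
-- that set gives D(G,k) = Σ_{j ≤ n} (k C j) e(j), where e(j) is the number of classes of
-- surjective distinguishing j-labelings. This is proved as a Newton expansion: let
-- F(k,i) count the classes in which all k − i last colours occur. Splitting by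
-- whether colour i occurs gives F(k+1,i+1) = F(k+1,i) + F(k,i).
-- Now e(0) = 0 because n ≥ 1, e(n) > 0 because an injective labeling is
-- distinguishing, and e(j) = 0 for j > n, so the right-hand side is a
-- polynomial of degree n without constant term. Its coefficient sum is D(G,1),
-- and the constant labeling is distinguishing only if G has no non-trivial automorphism.

open import Defs
open import Data.Fin.Base using (Fin; zero; suc; toℕ; fromℕ<; punchIn; punchOut; finToFun; funToFin; combine)
open import Data.Fin.Properties using (_≟_; any?; all?; toℕ<n; toℕ-injective; toℕ-fromℕ<; injective⇒≤; punchIn-injective; punchInᵢ≢i; punchIn-punchOut; finToFun-funToFin; funToFin-finToFin)
open import Data.Integer.Base as ℤ using (+_)
import Data.Integer.Properties as ℤₚ
open import Data.List.Base using (List; []; _∷_; length; lookup; filter; allFin)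
open import Data.List.Membership.Propositional using (_∈_)
open import Data.List.Membership.Propositional.Properties using (∈-allFin; ∈-lookup; ∈-filter⁺; ∈-filter⁻)
open import Data.List.Properties using (filter-all; filter-none; filter-some; filter-≐; length-tabulate)
import Data.List.Relation.Unary.All as All
open import Data.List.Relation.Unary.AllPairs using (_∷_)
import Data.List.Relation.Unary.Any as Any
import Data.List.Relation.Unary.Any.Properties as Anyₚ
open import Data.List.Relation.Unary.Unique.Propositional using (Unique)
open import Data.List.Relation.Unary.Unique.Propositional.Properties using (allFin⁺; filter⁺)
open import Data.Nat.Base using (ℕ; zero; suc; _+_; _*_; _≤_; _<_; _≥_; _^_; z≤n; s≤s; z<s; s<s)
open import Data.Nat.Combinatorics using (_C_; nCn≡1; nCk≡nC[n∸k]; nCk+nC[k+1]≡[n+1]C[k+1])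
import Data.Nat.Properties as ℕₚ
open import Data.Nat.Tactic.RingSolver using (solve-∀)
open import Data.Product.Base using (_×_; Σ-syntax; ∃-syntax; _,_; proj₁; proj₂)
open import Data.Rational.Base as ℚ using (ℚ; 0ℚ; 1ℚ; toℚᵘ; _/_)
import Data.Rational.Properties as ℚₚ
open import Data.Rational.Solver using (module +-*-Solver)
open import Data.Rational.Unnormalised.Base as ℚᵘ using (mkℚᵘ; *≡*)
import Data.Rational.Unnormalised.Properties as ℚᵘₚ
open import Function.Base using (_∘_; id)
open import Function.Bundles using (Bijection)
open import Level using (0ℓ)
open import Relation.Binary.PropositionalEquality using (_≡_; _≢_; _≗_; refl; sym; trans; cong; cong₂; subst; module ≡-Reasoning)
open import Relation.Nullary using (¬_; Dec; yes; no; contradiction)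
open import Relation.Nullary.Decidable using (_×-dec_; _→-dec_; ¬?; decidable-stable)
open import Relation.Unary using (Pred; Decidable)

-- Newton expansion

nC0≡1 : ∀ n → n C 0 ≡ 1
nC0≡1 n = trans (nCk≡nC[n∸k] {0} {n} z≤n) (nCn≡1 n)

-- Subtraction-free form of (k+1)·C(n,k+1) = (n-k)·C(n,k), hence valid for `k > n` too. It justifies
-- the factor (x - j)/(j + 1) in `newtonPoly`.
C-absorption : ∀ n k → suc k * (n C suc k) + k * (n C k) ≡ n * (n C k)
C-absorption zero    zero    = refl
C-absorption zero    (suc k) = cong₂ _+_ (ℕₚ.*-zeroʳ k) (ℕₚ.*-zeroʳ k)
C-absorption (suc n) zero    = begin
  1 * (suc n C 1) + 0      ≡⟨ cong (λ c → 1 * c + 0) (nCk+nC[k+1]≡[n+1]C[k+1] n 0) ⟨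
  1 * (n C 0 + n C 1) + 0  ≡⟨ regroup (n C 0) (n C 1) ⟩
  n C 0 + (1 * (n C 1) + 0 * (n C 0)) ≡⟨ cong₂ _+_ (nC0≡1 n) (C-absorption n 0) ⟩
  1 + n * (n C 0)          ≡⟨ cong (λ c → 1 + n * c) (nC0≡1 n) ⟩
  suc n * 1                ≡⟨ cong (suc n *_) (nC0≡1 (suc n)) ⟨
  suc n * (suc n C 0)      ∎
  where
  open ≡-Reasoning
  regroup : ∀ a b → 1 * (a + b) + 0 ≡ a + (1 * b + 0 * a)
  regroup = solve-∀
C-absorption (suc n) (suc k) = begin
  suc (suc k) * (suc n C suc (suc k)) + suc k * (suc n C suc k)
    ≡⟨ cong₂ (λ x y → suc (suc k) * x + suc k * y) (pascal (suc k)) (pascal k) ⟨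
  suc (suc k) * (b + c) + suc k * (a + b)
    ≡⟨ regroup k a b c ⟩
  (suc (suc k) * c + suc k * b) + b + ((suc k * b + k * a) + a)
    ≡⟨ cong₂ (λ x y → x + b + (y + a)) (C-absorption n (suc k)) (C-absorption n k) ⟩
  n * b + b + (n * a + a)
    ≡⟨ collect n a b ⟩
  suc n * (a + b)
    ≡⟨ cong (suc n *_) (pascal k) ⟩
  suc n * (suc n C suc k) ∎
  where
  open ≡-Reasoning
  a = n C k
  b = n C suc k
  c = n C suc (suc k)
  pascal = nCk+nC[k+1]≡[n+1]C[k+1] n
  regroup : ∀ k a b c → suc (suc k) * (b + c) + suc k * (a + b)
          ≡ (suc (suc k) * c + suc k * b) + b + ((suc k * b + k * a) + a)
  regroup = solve-∀
  collect : ∀ n a b → n * b + b + (n * a + a) ≡ suc n * (a + b)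
  collect = solve-∀

-- binomialSum e k j m = Σ_{i = j}^{j + m} (k C i) e(i)
binomialSum : (ℕ → ℕ) → ℕ → ℕ → ℕ → ℕ
binomialSum e k j zero    = (k C j) * e j
binomialSum e k j (suc m) = (k C j) * e j + binomialSum e k (suc j) m

-- Pascal's rule applied termwise. In `newton-expansion` it handles the terms of index at least 1
-- when the argument grows by one.
binomialSum-pascal : ∀ e k j m → binomialSum e (suc k) (suc j) m
  ≡ binomialSum (λ i → e (suc i)) k j m + binomialSum e k (suc j) m
binomialSum-pascal e k j zero = begin
  (suc k C suc j) * e (suc j)        ≡⟨ cong (_* e (suc j)) (nCk+nC[k+1]≡[n+1]C[k+1] k j) ⟨
  (k C j + k C suc j) * e (suc j)    ≡⟨ ℕₚ.*-distribʳ-+ (e (suc j)) (k C j) (k C suc j) ⟩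
  (k C j) * e (suc j) + (k C suc j) * e (suc j) ∎
  where open ≡-Reasoning
binomialSum-pascal e k j (suc m) = begin
  (suc k C suc j) * e (suc j) + binomialSum e (suc k) (suc (suc j)) m
    ≡⟨ cong₂ _+_ (binomialSum-pascal e k j zero) (binomialSum-pascal e k (suc j) m) ⟩
  (x + y) + (u + v)
    ≡⟨ interchange x y u v ⟩
  (x + u) + (y + v) ∎
  where
  open ≡-Reasoning
  x = (k C j) * e (suc j)
  y = (k C suc j) * e (suc j)
  u = binomialSum (λ i → e (suc i)) k (suc j) m
  v = binomialSum e k (suc (suc j)) m
  interchange : ∀ x y u v → (x + y) + (u + v) ≡ (x + u) + (y + v)
  interchange = solve-∀

-- The second hypothesis makes row `h (suc t)` the forward difference of row `h t`, so `h t 0` is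
-- the `t`-th difference of `h 0` at 0, and the series stops after `m`. The induction on `i` also
-- passes to the rows from `h 1` on, whose differences vanish one step sooner.
newton-expansion : (h : ℕ → ℕ → ℕ) → (∀ t i → h t (suc i) ≡ h (suc t) i + h t i) →
  ∀ m → (∀ t → m < t → h t 0 ≡ 0) →
  ∀ i → h 0 i ≡ binomialSum (λ t → h t 0) i 0 m
newton-expansion h Δ zero    van zero    = sym (ℕₚ.+-identityʳ (h 0 0))
newton-expansion h Δ (suc m) van zero    =
  sym (trans (cong₂ _+_ (ℕₚ.*-identityˡ (h 0 0)) (vanishes 1 m z<s)) (ℕₚ.+-identityʳ (h 0 0)))
  where
  -- `0 C suc j` computes to 0, so at argument 0 only the term of index 0 survives.
  vanishes : ∀ j m → 0 < j → binomialSum (λ t → h t 0) 0 j m ≡ 0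
  vanishes (suc j) zero    _ = refl
  vanishes (suc j) (suc m) _ = vanishes (suc (suc j)) m z<s
newton-expansion h Δ zero    van (suc i) = begin
  h 0 (suc i)                     ≡⟨ Δ 0 i ⟩
  h 1 i + h 0 i                   ≡⟨ cong₂ _+_ h1≡0 (newton-expansion h Δ zero van i) ⟩
  (i C 0) * h 0 0                 ≡⟨ cong (_* h 0 0) (trans (nC0≡1 i) (sym (nC0≡1 (suc i)))) ⟩
  (suc i C 0) * h 0 0             ∎
  where
  open ≡-Reasoning
  -- Row `h 1` expands into the single term with coefficient `h 1 0`, which already vanishes.
  h1≡0 : h 1 i ≡ 0
  h1≡0 = trans (newton-expansion (λ t → h (suc t)) (λ t → Δ (suc t)) zero (λ t p → van (suc t) z<s) i)
               (trans (cong ((i C 0) *_) (van 1 z<s)) (ℕₚ.*-zeroʳ (i C 0)))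
newton-expansion h Δ (suc m) van (suc i) = begin
  h 0 (suc i)
    ≡⟨ Δ 0 i ⟩
  h 1 i + h 0 i
    ≡⟨ cong₂ _+_ (newton-expansion (λ t → h (suc t)) (λ t → Δ (suc t)) m (λ t p → van (suc t) (s<s p)) i)
                 (newton-expansion h Δ (suc m) van i) ⟩
  x + ((i C 0) * h 0 0 + y)
    ≡⟨ rotate x ((i C 0) * h 0 0) y ⟩
  (i C 0) * h 0 0 + (x + y)
    ≡⟨ cong₂ _+_ (cong (_* h 0 0) (trans (nC0≡1 i) (sym (nC0≡1 (suc i)))))
                 (sym (binomialSum-pascal (λ t → h t 0) i 0 m)) ⟩
  (suc i C 0) * h 0 0 + binomialSum (λ t → h t 0) (suc i) 1 m ∎
  where
  open ≡-Reasoning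
  x = binomialSum (λ t → h (suc t) 0) i 0 m
  y = binomialSum (λ t → h t 0) i 1 m
  rotate : ∀ x y z → x + (y + z) ≡ y + (x + z)
  rotate = solve-∀

-- Embedding of ℕ in ℚ

-- Elements of ℚ are kept in lowest terms, which blocks computation on variables. The identities
-- below are therefore checked on unnormalised fractions, where they are integer arithmetic.
toℚᵘ-/ : ∀ i d → toℚᵘ (i / suc d) ℚᵘ.≃ mkℚᵘ i d
toℚᵘ-/ i d = ℚₚ.toℚᵘ-fromℚᵘ (mkℚᵘ i d)

ℕ→ℚ-+ : ∀ a b → ℕ→ℚ (a + b) ≡ ℕ→ℚ a ℚ.+ ℕ→ℚ b
ℕ→ℚ-+ a b = ℚₚ.toℚᵘ-injective (begin
  toℚᵘ (ℕ→ℚ (a + b))                ≈⟨ toℚᵘ-/ (+ (a + b)) 0 ⟩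
  mkℚᵘ (+ (a + b)) 0                ≈⟨ *≡* (cong (ℤ._* + 1) (cong₂ ℤ._+_ (ℤₚ.*-identityʳ (+ a)) (ℤₚ.*-identityʳ (+ b)))) ⟨
  mkℚᵘ (+ a) 0 ℚᵘ.+ mkℚᵘ (+ b) 0    ≈⟨ ℚᵘₚ.+-cong (toℚᵘ-/ (+ a) 0) (toℚᵘ-/ (+ b) 0) ⟨
  toℚᵘ (ℕ→ℚ a) ℚᵘ.+ toℚᵘ (ℕ→ℚ b)    ≈⟨ ℚₚ.toℚᵘ-homo-+ (ℕ→ℚ a) (ℕ→ℚ b) ⟨
  toℚᵘ (ℕ→ℚ a ℚ.+ ℕ→ℚ b)            ∎)
  where open ℚᵘₚ.≃-Reasoning

ℕ→ℚ-* : ∀ a b → ℕ→ℚ (a * b) ≡ ℕ→ℚ a ℚ.* ℕ→ℚ b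
ℕ→ℚ-* a b = ℚₚ.toℚᵘ-injective (begin
  toℚᵘ (ℕ→ℚ (a * b))                ≈⟨ toℚᵘ-/ (+ (a * b)) 0 ⟩
  mkℚᵘ (+ (a * b)) 0                ≈⟨ *≡* (cong (ℤ._* + 1) (ℤₚ.pos-* a b)) ⟩
  mkℚᵘ (+ a) 0 ℚᵘ.* mkℚᵘ (+ b) 0    ≈⟨ ℚᵘₚ.*-cong (toℚᵘ-/ (+ a) 0) (toℚᵘ-/ (+ b) 0) ⟨
  toℚᵘ (ℕ→ℚ a) ℚᵘ.* toℚᵘ (ℕ→ℚ b)    ≈⟨ ℚₚ.toℚᵘ-homo-* (ℕ→ℚ a) (ℕ→ℚ b) ⟨
  toℚᵘ (ℕ→ℚ a ℚ.* ℕ→ℚ b)            ∎)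
  where open ℚᵘₚ.≃-Reasoning

ℕ→ℚ-≢0 : ∀ {a} → 0 < a → ℕ→ℚ a ≢ 0ℚ
ℕ→ℚ-≢0 {suc a} _ eq
  with *≡* () ← ℚᵘₚ.≃-trans (ℚᵘₚ.≃-sym (toℚᵘ-/ (+ suc a) 0)) (ℚᵘₚ.≃-reflexive (cong toℚᵘ eq))

1/suc : ℕ → ℚ
1/suc j = + 1 / suc j

1/suc-inverse : ∀ j → 1/suc j ℚ.* ℕ→ℚ (suc j) ≡ 1ℚ
1/suc-inverse j = ℚₚ.toℚᵘ-injective (begin
  toℚᵘ (1/suc j ℚ.* ℕ→ℚ (suc j))         ≈⟨ ℚₚ.toℚᵘ-homo-* (1/suc j) (ℕ→ℚ (suc j)) ⟩
  toℚᵘ (1/suc j) ℚᵘ.* toℚᵘ (ℕ→ℚ (suc j)) ≈⟨ ℚᵘₚ.*-cong (toℚᵘ-/ (+ 1) j) (toℚᵘ-/ (+ suc j) 0) ⟩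
  mkℚᵘ (+ 1) j ℚᵘ.* mkℚᵘ (+ suc j) 0     ≈⟨ *≡* (ℤₚ.*-assoc (+ 1) (+ suc j) (+ 1)) ⟩
  toℚᵘ 1ℚ ∎)
  where open ℚᵘₚ.≃-Reasoning

-- Polynomials

-- affine c d r q is the coefficient list of (c x + d) q + r.
affine : ℚ → ℚ → ℚ → Polynomial → Polynomial
affine c d r []      = r ∷ []
affine c d r (a ∷ q) = d ℚ.* a ℚ.+ r ∷ affine c d (c ℚ.* a) q

eval-affine : ∀ c d r q x → eval (affine c d r q) x ≡ r ℚ.+ (c ℚ.* x ℚ.+ d) ℚ.* eval q x
eval-affine c d r []      x = cong (r ℚ.+_) (trans (ℚₚ.*-zeroʳ x) (sym (ℚₚ.*-zeroʳ (c ℚ.* x ℚ.+ d))))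
eval-affine c d r (a ∷ q) x = begin
  d ℚ.* a ℚ.+ r ℚ.+ x ℚ.* eval (affine c d (c ℚ.* a) q) x
    ≡⟨ cong (λ y → d ℚ.* a ℚ.+ r ℚ.+ x ℚ.* y) (eval-affine c d (c ℚ.* a) q x) ⟩
  d ℚ.* a ℚ.+ r ℚ.+ x ℚ.* (c ℚ.* a ℚ.+ (c ℚ.* x ℚ.+ d) ℚ.* eval q x)
    ≡⟨ solve 6 (λ c d r a x v →
         d :* a :+ r :+ x :* (c :* a :+ (c :* x :+ d) :* v) := r :+ (c :* x :+ d) :* (a :+ x :* v))
         refl c d r a x (eval q x) ⟩
  r ℚ.+ (c ℚ.* x ℚ.+ d) ℚ.* (a ℚ.+ x ℚ.* eval q x) ∎
  where
  open ≡-Reasoning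
  open +-*-Solver

coeff-affine-zero : ∀ c d r q → coeff (affine c d r q) 0 ≡ d ℚ.* coeff q 0 ℚ.+ r
coeff-affine-zero c d r []      = sym (trans (cong (ℚ._+ r) (ℚₚ.*-zeroʳ d)) (ℚₚ.+-identityˡ r))
coeff-affine-zero c d r (a ∷ q) = refl

coeff-affine-suc : ∀ c d r q i →
  coeff (affine c d r q) (suc i) ≡ d ℚ.* coeff q (suc i) ℚ.+ c ℚ.* coeff q i
coeff-affine-suc c d r []      i       = sym (cong₂ ℚ._+_ (ℚₚ.*-zeroʳ d) (ℚₚ.*-zeroʳ c))
coeff-affine-suc c d r (a ∷ q) zero    = coeff-affine-zero c d (c ℚ.* a) q
coeff-affine-suc c d r (a ∷ q) (suc i) = coeff-affine-suc c d (c ℚ.* a) q i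

coeffSum≡eval1 : ∀ p → coeffSum p ≡ eval p 1ℚ
coeffSum≡eval1 []      = refl
coeffSum≡eval1 (a ∷ p) = cong (a ℚ.+_) (trans (coeffSum≡eval1 p) (sym (ℚₚ.*-identityˡ (eval p 1ℚ))))

-- Horner form of the Newton series: P_j = e(j) + (x − j)/(j + 1) · P_{j+1}.
newtonPoly : (ℕ → ℕ) → ℕ → ℕ → Polynomial
newtonPoly e j zero    = ℕ→ℚ (e j) ∷ []
newtonPoly e j (suc m) =
  affine (1/suc j) (ℚ.- (1/suc j ℚ.* ℕ→ℚ j)) (ℕ→ℚ (e j)) (newtonPoly e (suc j) m)

C-absorptionℚ : ∀ k j → ℕ→ℚ (suc j) ℚ.* ℕ→ℚ (k C suc j) ℚ.+ ℕ→ℚ j ℚ.* ℕ→ℚ (k C j) ≡ ℕ→ℚ k ℚ.* ℕ→ℚ (k C j)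
C-absorptionℚ k j = begin
  ℕ→ℚ (suc j) ℚ.* ℕ→ℚ (k C suc j) ℚ.+ ℕ→ℚ j ℚ.* ℕ→ℚ (k C j)
    ≡⟨ cong₂ ℚ._+_ (ℕ→ℚ-* (suc j) (k C suc j)) (ℕ→ℚ-* j (k C j)) ⟨
  ℕ→ℚ (suc j * (k C suc j)) ℚ.+ ℕ→ℚ (j * (k C j))
    ≡⟨ ℕ→ℚ-+ (suc j * (k C suc j)) (j * (k C j)) ⟨
  ℕ→ℚ (suc j * (k C suc j) + j * (k C j))
    ≡⟨ cong ℕ→ℚ (C-absorption k j) ⟩
  ℕ→ℚ (k * (k C j))
    ≡⟨ ℕ→ℚ-* k (k C j) ⟩
  ℕ→ℚ k ℚ.* ℕ→ℚ (k C j) ∎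
  where open ≡-Reasoning

-- The prefactor `k C j` drives the induction: by absorption, multiplying it by the Horner factor (k
-- - j)/(j + 1) yields `k C suc j`, the prefactor of the next stage. At `j = 0` it is 1.
eval-newtonPoly : ∀ e k j m →
  ℕ→ℚ (k C j) ℚ.* eval (newtonPoly e j m) (ℕ→ℚ k) ≡ ℕ→ℚ (binomialSum e k j m)
eval-newtonPoly e k j zero = begin
  ℕ→ℚ (k C j) ℚ.* (ℕ→ℚ (e j) ℚ.+ ℕ→ℚ k ℚ.* 0ℚ)
    ≡⟨ cong (λ z → ℕ→ℚ (k C j) ℚ.* (ℕ→ℚ (e j) ℚ.+ z)) (ℚₚ.*-zeroʳ (ℕ→ℚ k)) ⟩
  ℕ→ℚ (k C j) ℚ.* (ℕ→ℚ (e j) ℚ.+ 0ℚ)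
    ≡⟨ cong (ℕ→ℚ (k C j) ℚ.*_) (ℚₚ.+-identityʳ (ℕ→ℚ (e j))) ⟩
  ℕ→ℚ (k C j) ℚ.* ℕ→ℚ (e j)
    ≡⟨ ℕ→ℚ-* (k C j) (e j) ⟨
  ℕ→ℚ ((k C j) * e j) ∎
  where open ≡-Reasoning
eval-newtonPoly e k j (suc m) = begin
  B ℚ.* eval (newtonPoly e j (suc m)) K
    ≡⟨ cong (B ℚ.*_) (eval-affine c (ℚ.- (c ℚ.* J)) E (newtonPoly e (suc j) m) K) ⟩
  B ℚ.* (E ℚ.+ (c ℚ.* K ℚ.+ ℚ.- (c ℚ.* J)) ℚ.* V)
    ≡⟨ solve 6 (λ B E c K J V →
         B :* (E :+ (c :* K :+ :- (c :* J)) :* V) := B :* E :+ c :* (K :* B :+ :- (J :* B)) :* V)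
         refl B E c K J V ⟩
  B ℚ.* E ℚ.+ c ℚ.* (K ℚ.* B ℚ.+ ℚ.- (J ℚ.* B)) ℚ.* V
    ≡⟨ cong (λ z → B ℚ.* E ℚ.+ c ℚ.* (z ℚ.+ ℚ.- (J ℚ.* B)) ℚ.* V) (C-absorptionℚ k j) ⟨
  B ℚ.* E ℚ.+ c ℚ.* (S ℚ.* B′ ℚ.+ J ℚ.* B ℚ.+ ℚ.- (J ℚ.* B)) ℚ.* V
    ≡⟨ solve 7 (λ B E c S B′ J V →
         B :* E :+ c :* (S :* B′ :+ J :* B :+ :- (J :* B)) :* V := B :* E :+ (c :* S) :* (B′ :* V))
         refl B E c S B′ J V ⟩
  B ℚ.* E ℚ.+ (c ℚ.* S) ℚ.* (B′ ℚ.* V)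
    ≡⟨ cong (λ z → B ℚ.* E ℚ.+ z ℚ.* (B′ ℚ.* V)) (1/suc-inverse j) ⟩
  B ℚ.* E ℚ.+ 1ℚ ℚ.* (B′ ℚ.* V)
    ≡⟨ cong (B ℚ.* E ℚ.+_) (ℚₚ.*-identityˡ (B′ ℚ.* V)) ⟩
  B ℚ.* E ℚ.+ B′ ℚ.* V
    ≡⟨ cong₂ ℚ._+_ (sym (ℕ→ℚ-* (k C j) (e j))) (eval-newtonPoly e k (suc j) m) ⟩
  ℕ→ℚ ((k C j) * e j) ℚ.+ ℕ→ℚ (binomialSum e k (suc j) m)
    ≡⟨ ℕ→ℚ-+ ((k C j) * e j) (binomialSum e k (suc j) m) ⟨
  ℕ→ℚ (binomialSum e k j (suc m)) ∎
  where
  open ≡-Reasoning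
  open +-*-Solver
  B B′ E J K S V c : ℚ
  B  = ℕ→ℚ (k C j)
  B′ = ℕ→ℚ (k C suc j)
  E  = ℕ→ℚ (e j)
  J  = ℕ→ℚ j
  K  = ℕ→ℚ k
  S  = ℕ→ℚ (suc j)
  V  = eval (newtonPoly e (suc j) m) K
  c  = 1/suc j

-- Each Horner step raises the degree by one and multiplies the leading coefficient by 1/(j + 1), so
-- the final one is a positive multiple of `e (m + j)`.
newtonPoly-degree : ∀ e j m → 0 < e (m + j) → HasDegree (newtonPoly e j m) m
newtonPoly-degree e j zero    pos = ℕ→ℚ-≢0 pos , λ { (suc i) _ → refl }
newtonPoly-degree e j (suc m) pos = lead≢0 , above
  where
  open ≡-Reasoning
  c d : ℚ
  c = 1/suc j
  d = ℚ.- (c ℚ.* ℕ→ℚ j)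
  q : Polynomial
  q = newtonPoly e (suc j) m
  step : ∀ i → coeff (newtonPoly e j (suc m)) (suc i) ≡ d ℚ.* coeff q (suc i) ℚ.+ c ℚ.* coeff q i
  step = coeff-affine-suc c d (ℕ→ℚ (e j)) q
  deg : HasDegree q m
  deg = newtonPoly-degree e (suc j) m (subst (λ t → 0 < e t) (sym (ℕₚ.+-suc m j)) pos)
  lead≢0 : coeff (newtonPoly e j (suc m)) (suc m) ≢ 0ℚ
  -- The `d`-term vanishes since `q` has no coefficient above `m`; multiplying `c * coeff q m` by
  -- `suc j` then recovers `coeff q m`.
  lead≢0 eq = let (q≢0 , q≡0) = deg in q≢0 (begin
    coeff q m                            ≡⟨ ℚₚ.*-identityˡ (coeff q m) ⟨
    1ℚ ℚ.* coeff q m                     ≡⟨ cong (ℚ._* coeff q m) (trans (ℚₚ.*-comm (ℕ→ℚ (suc j)) c) (1/suc-inverse j)) ⟨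
    ℕ→ℚ (suc j) ℚ.* c ℚ.* coeff q m      ≡⟨ ℚₚ.*-assoc (ℕ→ℚ (suc j)) c (coeff q m) ⟩
    ℕ→ℚ (suc j) ℚ.* (c ℚ.* coeff q m)    ≡⟨ cong (ℕ→ℚ (suc j) ℚ.*_) (begin
      c ℚ.* coeff q m                              ≡⟨ ℚₚ.+-identityˡ (c ℚ.* coeff q m) ⟨
      0ℚ ℚ.+ c ℚ.* coeff q m                       ≡⟨ cong (ℚ._+ c ℚ.* coeff q m) (trans (cong (d ℚ.*_) (q≡0 (suc m) ℕₚ.≤-refl)) (ℚₚ.*-zeroʳ d)) ⟨
      d ℚ.* coeff q (suc m) ℚ.+ c ℚ.* coeff q m    ≡⟨ step m ⟨
      coeff (newtonPoly e j (suc m)) (suc m)       ≡⟨ eq ⟩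
      0ℚ                                           ∎) ⟩
    ℕ→ℚ (suc j) ℚ.* 0ℚ                   ≡⟨ ℚₚ.*-zeroʳ (ℕ→ℚ (suc j)) ⟩
    0ℚ ∎)
  above : ∀ i → suc m < i → coeff (newtonPoly e j (suc m)) i ≡ 0ℚ
  above (suc i) (s≤s m<i) = let (_ , q≡0) = deg in trans (step i) (cong₂ ℚ._+_
    (trans (cong (d ℚ.*_) (q≡0 (suc i) (ℕₚ.m≤n⇒m≤1+n m<i))) (ℚₚ.*-zeroʳ d))
    (trans (cong (c ℚ.*_) (q≡0 i m<i)) (ℚₚ.*-zeroʳ c)))

newtonPoly-coeff0 : ∀ e m → e 0 ≡ 0 → coeff (newtonPoly e 0 (suc m)) 0 ≡ 0ℚ
newtonPoly-coeff0 e m e0≡0 = begin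
  -- At `j = 0` the linear factor is x itself: its constant part computes to `0ℚ`.
  coeff (newtonPoly e 0 (suc m)) 0             ≡⟨ coeff-affine-zero _ 0ℚ (ℕ→ℚ (e 0)) (newtonPoly e 1 m) ⟩
  0ℚ ℚ.* coeff (newtonPoly e 1 m) 0 ℚ.+ ℕ→ℚ (e 0) ≡⟨ cong₂ ℚ._+_ (ℚₚ.*-zeroˡ (coeff (newtonPoly e 1 m) 0)) (cong ℕ→ℚ e0≡0) ⟩
  0ℚ                                           ∎
  where open ≡-Reasoning

-- Counting elements of Fin N

lookup-injective : ∀ {A : Set} {xs : List A} → Unique xs → ∀ i j → lookup xs i ≡ lookup xs j → i ≡ j
lookup-injective (x≢ ∷ _)  zero    zero    _  = refl
lookup-injective (x≢ ∷ _)  zero    (suc j) eq = contradiction eq (All.lookup x≢ (∈-lookup j))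
lookup-injective (x≢ ∷ _)  (suc i) zero    eq = contradiction (sym eq) (All.lookup x≢ (∈-lookup i))
lookup-injective (_  ∷ xs!) (suc i) (suc j) eq = cong suc (lookup-injective xs! i j eq)

count : ∀ {N} {P : Pred (Fin N) 0ℓ} → Decidable P → ℕ
count {N} P? = length (filter P? (allFin N))

module _ {M N : ℕ} {P : Pred (Fin M) 0ℓ} {Q : Pred (Fin N) 0ℓ} (P? : Decidable P) (Q? : Decidable Q)
         (R : Fin M → Fin N → Set)
         (total : ∀ i → P i → ∃[ j ] (Q j × R i j))
         (injective : ∀ {i i′ j} → R i j → R i′ j → i ≡ i′) where

  -- Sending each listed element to the position of a related one is injective. With a relation in
  -- place of a function, the image may depend on the proof of `P i`.
  count-mono : count P? ≤ count Q?
  count-mono = injective⇒≤ {f = f} λ {a} {b} eq →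
    lookup-injective (filter⁺ P? (allFin⁺ M)) a b
      (injective (proj₂ (proj₂ (image a)))
                 (subst (R _) (trans (Anyₚ.lookup-index (mem b)) (trans (cong (lookup ys) (sym eq)) (sym (Anyₚ.lookup-index (mem a)))))
                   (proj₂ (proj₂ (image b)))))
    where
    xs : List (Fin M)
    xs = filter P? (allFin M)
    ys : List (Fin N)
    ys = filter Q? (allFin N)
    image : ∀ a → ∃[ j ] (Q j × R (lookup xs a) j)
    image a = total (lookup xs a) (proj₂ (∈-filter⁻ P? {xs = allFin M} (∈-lookup a)))
    mem : ∀ a → proj₁ (image a) ∈ ys
    mem a = ∈-filter⁺ Q? (∈-allFin _) (proj₁ (proj₂ (image a)))
    f : Fin (count P?) → Fin (count Q?)
    f a = Any.index (mem a)

count-split : ∀ {N} {P Q : Pred (Fin N) 0ℓ} (P? : Decidable P) (Q? : Decidable Q) →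
  count P? ≡ count (λ i → P? i ×-dec Q? i) + count (λ i → P? i ×-dec ¬? (Q? i))
count-split {N} P? Q? = go (allFin N)
  where
  go : ∀ xs → length (filter P? xs) ≡
    length (filter (λ i → P? i ×-dec Q? i) xs) + length (filter (λ i → P? i ×-dec ¬? (Q? i)) xs)
  go [] = refl
  go (x ∷ xs) with P? x | Q? x
  ... | yes _ | yes _ = cong suc (go xs)
  ... | yes _ | no  _ = trans (cong suc (go xs)) (sym (ℕₚ.+-suc _ _))
  ... | no  _ | yes _ = go xs
  ... | no  _ | no  _ = go xs

count-cong : ∀ {N} {P Q : Pred (Fin N) 0ℓ} (P? : Decidable P) (Q? : Decidable Q) →
  (∀ {i} → P i → Q i) → (∀ {i} → Q i → P i) → count P? ≡ count Q?
count-cong {N} P? Q? P⇒Q Q⇒P = cong length (filter-≐ P? Q? (P⇒Q , Q⇒P) (allFin N))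

count-all : ∀ {N} {P : Pred (Fin N) 0ℓ} (P? : Decidable P) → (∀ i → P i) → count P? ≡ N
count-all {N} P? p = trans (cong length (filter-all P? (All.universal p (allFin N)))) (length-tabulate id)

count-none : ∀ {N} {P : Pred (Fin N) 0ℓ} (P? : Decidable P) → (∀ i → ¬ P i) → count P? ≡ 0
count-none {N} P? p = cong length (filter-none P? (All.universal p (allFin N)))

count-some : ∀ {N} {P : Pred (Fin N) 0ℓ} (P? : Decidable P) {i} → P i → 0 < count P?
count-some P? {i} p = filter-some P? (Any.map (λ { refl → p }) (∈-allFin i))

¬Fin⇒≡0 : ∀ {N} → ¬ Fin N → N ≡ 0
¬Fin⇒≡0 {zero}  _  = refl
¬Fin⇒≡0 {suc _} ¬f = contradiction zero ¬f

-- Shifting past a value, and codes of functions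

punchIn-≤⁺ : ∀ {k} (d : Fin (suc k)) c → toℕ d ≤ toℕ c → toℕ d < toℕ (punchIn d c)
punchIn-≤⁺ zero    c       _         = z<s
punchIn-≤⁺ (suc d) (suc c) (s≤s d≤c) = s≤s (punchIn-≤⁺ d c d≤c)

punchIn-≤⁻ : ∀ {k} (d : Fin (suc k)) c → toℕ d < toℕ (punchIn d c) → toℕ d ≤ toℕ c
punchIn-≤⁻ zero    c       _         = z≤n
punchIn-≤⁻ (suc d) (suc c) (s≤s d<c) = s≤s (punchIn-≤⁻ d c d<c)

funToFin-cong : ∀ {m n} {f g : Fin m → Fin n} → f ≗ g → funToFin f ≡ funToFin g
funToFin-cong {zero}  f≗g = refl
funToFin-cong {suc m} f≗g = cong₂ combine (f≗g zero) (funToFin-cong (f≗g ∘ suc))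

finToFun-injective : ∀ {m n} (i j : Fin (n ^ m)) → finToFun {n} {m} i ≗ finToFun j → i ≡ j
finToFun-injective {m} {n} i j eq =
  trans (sym (funToFin-finToFin {m} {n} i)) (trans (funToFin-cong eq) (funToFin-finToFin {m} {n} j))

-- Labelings and their colours

Uses : ∀ {n k} → Labeling n k → Fin k → Set
Uses φ c = ∃[ v ] φ v ≡ c

uses? : ∀ {n k} (φ : Labeling n k) c → Dec (Uses φ c)
uses? φ c = any? λ v → φ v ≟ c

-- The bound is a number and not a colour, so that `i = k` is allowed; the condition is then void.
UsesFrom : ∀ {n k} → ℕ → Labeling n k → Set
UsesFrom i φ = ∀ c → i ≤ toℕ c → Uses φ c

usesFrom? : ∀ {n k} i (φ : Labeling n k) → Dec (UsesFrom i φ)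
usesFrom? i φ = all? λ c → (i ℕₚ.≤? toℕ c) →-dec uses? φ c

-- Choosing a vertex of each colour injects colours into vertices.
surjective⇒≤ : ∀ {n k} (φ : Labeling n k) → UsesFrom 0 φ → k ≤ n
surjective⇒≤ φ surj = injective⇒≤ {f = λ c → proj₁ (surj c z≤n)} λ {c} {c′} eq →
  trans (sym (proj₂ (surj c z≤n))) (trans (cong φ eq) (proj₂ (surj c′ z≤n)))

usesFrom-suc⁺ : ∀ {n k} (d : Fin k) {φ : Labeling n k} → UsesFrom (suc (toℕ d)) φ → Uses φ d → UsesFrom (toℕ d) φ
usesFrom-suc⁺ d {φ} uses ud c d≤c with d ≟ c
... | yes refl = ud
... | no  d≢c  = uses c (ℕₚ.≤∧≢⇒< d≤c (d≢c ∘ toℕ-injective))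

module _ {n k : ℕ} (d : Fin (suc k)) where

  insertColour : Labeling n k → Labeling n (suc k)
  insertColour φ = punchIn d ∘ φ

  insertColour-omits : ∀ φ → ¬ Uses (insertColour φ) d
  insertColour-omits φ (v , eq) = punchInᵢ≢i d (φ v) eq

  -- The colours above `d` are exactly the images under `punchIn d` of the old colours from `d` on.
  insertColour-usesFrom⁺ : ∀ {φ} → UsesFrom (toℕ d) φ → UsesFrom (suc (toℕ d)) (insertColour φ)
  insertColour-usesFrom⁺ {φ} uses c d<c =
    let d≢c : d ≢ c
        d≢c = λ { refl → ℕₚ.<-irrefl refl d<c }
        c≡ = punchIn-punchOut d≢c
        (v , eq) = uses (punchOut d≢c) (punchIn-≤⁻ d _ (subst (λ x → toℕ d < toℕ x) (sym c≡) d<c))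
    in v , trans (cong (punchIn d) eq) c≡

  insertColour-usesFrom⁻ : ∀ {φ} → UsesFrom (suc (toℕ d)) (insertColour φ) → UsesFrom (toℕ d) φ
  insertColour-usesFrom⁻ {φ} uses c d≤c =
    let (v , eq) = uses (punchIn d c) (punchIn-≤⁺ d c d≤c) in v , punchIn-injective d _ _ eq

  removeColour : (ψ : Labeling n (suc k)) → ¬ Uses ψ d → Labeling n k
  removeColour ψ omits v = punchOut {i = d} {j = ψ v} λ eq → omits (v , sym eq)

  insert-remove : ∀ ψ omits → insertColour (removeColour ψ omits) ≗ ψ
  insert-remove ψ omits v = punchIn-punchOut _

-- Classes of distinguishing labelings and their representatives

module _ {n : ℕ} (G : Graph n) where

  -- An automorphism moves vertices and keeps labels, so the set of colours that occur is an
  -- invariant of the class.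
  uses-resp : ∀ {k c} {φ ψ : Labeling n k} → Equivalent G φ ψ → Uses φ c → Uses ψ c
  uses-resp (π , e) (v , eq) = apply G π v , trans (e v) eq

  usesFrom-resp : ∀ {k i} {φ ψ : Labeling n k} → Equivalent G φ ψ → UsesFrom i φ → UsesFrom i ψ
  usesFrom-resp {φ = φ} {ψ} e uses c i≤c = uses-resp {φ = φ} {ψ} e (uses c i≤c)

  module _ {k : ℕ} where

    rep : Fin (D G k) → Labeling n k
    rep i = proj₁ (Bijection.to (D-counts G k) i)

    rep-distinguishing : ∀ i → Distinguishing G (rep i)
    rep-distinguishing i = proj₂ (Bijection.to (D-counts G k) i)

    rep-injective : ∀ {i j} → Equivalent G (rep i) (rep j) → i ≡ j
    rep-injective = Bijection.injective (D-counts G k)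

    class : (φ : Labeling n k) → Distinguishing G φ → Fin (D G k)
    class φ d = Bijection.to⁻ (D-counts G k) (φ , d)

    rep-class : ∀ φ d → Equivalent G (rep (class φ d)) φ
    rep-class φ d = proj₂ (Bijection.surjective (D-counts G k) (φ , d)) refl

    class-rep : ∀ φ d → Equivalent G φ (rep (class φ d))
    class-rep φ d = equivalent-sym G {φ = rep (class φ d)} {φ} (rep-class φ d)

  module _ {k : ℕ} (d : Fin (suc k)) where

    -- Since `punchIn d` is injective, two labels agree before insertion exactly when they agree
    -- after it; this gives all four transfers.
    insertColour-equivalent⁺ : ∀ {φ ψ : Labeling n k} → Equivalent G φ ψ →
      Equivalent G (insertColour d φ) (insertColour d ψ)
    insertColour-equivalent⁺ (π , e) = π , λ v → cong (punchIn d) (e v)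

    insertColour-equivalent⁻ : ∀ {φ ψ : Labeling n k} →
      Equivalent G (insertColour d φ) (insertColour d ψ) → Equivalent G φ ψ
    insertColour-equivalent⁻ (π , e) = π , λ v → punchIn-injective d _ _ (e v)

    insertColour-distinguishing⁺ : ∀ {φ} → Distinguishing G φ → Distinguishing G (insertColour d φ)
    insertColour-distinguishing⁺ dist π pr = dist π λ v → punchIn-injective d _ _ (pr v)

    insertColour-distinguishing⁻ : ∀ {φ} → Distinguishing G (insertColour d φ) → Distinguishing G φ
    insertColour-distinguishing⁻ dist π pr = dist π λ v → cong (punchIn d) (pr v)

  -- usingFrom k i counts the classes of distinguishing k-labelings in which all
  -- colours c ≥ i occur; thus i = k gives D G k, and i = 0 the surjective ones.
  usingFrom? : ∀ k i → Decidable (λ a → UsesFrom i (rep {k} a))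
  usingFrom? k i a = usesFrom? i (rep a)

  usingFrom : ℕ → ℕ → ℕ
  usingFrom k i = count (usingFrom? k i)

  -- Classes in which `d` occurs have all colours from `d` on. In the others `d` can be deleted,
  -- which leaves a class of `k`-labelings with all colours from `d` on.
  usingFrom-recurrence′ : ∀ {k} (d : Fin (suc k)) →
    usingFrom (suc k) (suc (toℕ d)) ≡ usingFrom (suc k) (toℕ d) + usingFrom k (toℕ d)
  usingFrom-recurrence′ {k} d = trans (count-split above? uses-d?) (cong₂ _+_ containing omitting)
    where
    above? = usingFrom? (suc k) (suc (toℕ d))
    uses-d? : Decidable (λ a → Uses (rep {suc k} a) d)
    uses-d? a = uses? (rep a) d
    omits? = λ a → above? a ×-dec ¬? (uses-d? a)

    containing : count (λ a → above? a ×-dec uses-d? a) ≡ usingFrom (suc k) (toℕ d)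
    containing = count-cong _ (usingFrom? (suc k) (toℕ d))
      (λ (u , ud) → usesFrom-suc⁺ d u ud)
      (λ u → (λ c d<c → u c (ℕₚ.<⇒≤ d<c)) , u d ℕₚ.≤-refl)

    -- Inserting `d` into a representative gives a labeling that need only be equivalent to a
    -- representative, so classes are matched by a relation.
    Matches : Fin (D G k) → Fin (D G (suc k)) → Set
    Matches a b = Equivalent G (insertColour d (rep a)) (rep b)

    matches-functional : ∀ {a b b′} → Matches a b → Matches a b′ → b ≡ b′
    matches-functional {a} {b} {b′} m m′ = rep-injective
      (equivalent-trans G {φ = rep b} {insertColour d (rep a)} {rep b′}
        (equivalent-sym G {φ = insertColour d (rep a)} {rep b} m) m′)

    matches-injective : ∀ {a a′ b} → Matches a b → Matches a′ b → a ≡ a′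
    matches-injective {a} {a′} {b} m m′ = rep-injective
      (insertColour-equivalent⁻ d {rep a} {rep a′}
        (equivalent-trans G {φ = insertColour d (rep a)} {rep b} {insertColour d (rep a′)}
          m (equivalent-sym G {φ = insertColour d (rep a′)} {rep b} m′)))

    inserted : ∀ a → UsesFrom (toℕ d) (rep {k} a) →
      ∃[ b ] ((UsesFrom (suc (toℕ d)) (rep {suc k} b) × ¬ Uses (rep b) d) × Matches a b)
    inserted a u = b
      , ( usesFrom-resp {φ = φ} {rep b} φ~b (insertColour-usesFrom⁺ d u)
        , λ ub → insertColour-omits d (rep a) (uses-resp {φ = rep b} {φ} (rep-class φ dist) ub))
      , φ~b
      where
      φ : Labeling n (suc k)
      φ = insertColour d (rep a)
      dist : Distinguishing G φ
      dist = insertColour-distinguishing⁺ d (rep-distinguishing a)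
      b : Fin (D G (suc k))
      b = class φ dist
      φ~b : Equivalent G φ (rep b)
      φ~b = class-rep φ dist

    removed : ∀ b → UsesFrom (suc (toℕ d)) (rep {suc k} b) × ¬ Uses (rep b) d →
      ∃[ a ] (UsesFrom (toℕ d) (rep {k} a) × Matches a b)
    removed b (u , omits) = a
      , usesFrom-resp {φ = φ} {rep a} (class-rep φ dist)
          (insertColour-usesFrom⁻ d (usesFrom-resp {φ = rep b} {insertColour d φ} b~φ u))
      , equivalent-trans G {φ = insertColour d (rep a)} {insertColour d φ} {rep b}
          (insertColour-equivalent⁺ d {rep a} {φ} (rep-class φ dist))
          (equivalent-sym G {φ = rep b} {insertColour d φ} b~φ)
      where
      φ : Labeling n k
      φ = removeColour d (rep b) omits
      b~φ : Equivalent G (rep b) (insertColour d φ)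
      b~φ = ≗⇒equivalent G λ v → sym (insert-remove d (rep b) omits v)
      dist : Distinguishing G φ
      dist = insertColour-distinguishing⁻ d
        (distinguishing-resp G {φ = rep b} {insertColour d φ} b~φ (rep-distinguishing b))
      a : Fin (D G k)
      a = class φ dist

    omitting : count omits? ≡ usingFrom k (toℕ d)
    -- `Matches` is injective and functional, so it serves for both inequalities.
    omitting = ℕₚ.≤-antisym
      (count-mono omits? (usingFrom? k (toℕ d)) (λ b a → Matches a b) removed
        λ {b} {b′} {a} → matches-functional {a} {b} {b′})
      (count-mono (usingFrom? k (toℕ d)) omits? Matches inserted
        λ {a} {a′} {b} → matches-injective {a} {a′} {b})

  usingFrom-recurrence : ∀ {k i} → i ≤ k →
    usingFrom (suc k) (suc i) ≡ usingFrom (suc k) i + usingFrom k i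
  usingFrom-recurrence {k} i≤k =
    subst (λ i → usingFrom (suc k) (suc i) ≡ usingFrom (suc k) i + usingFrom k i)
      (toℕ-fromℕ< (s≤s i≤k)) (usingFrom-recurrence′ (fromℕ< (s≤s i≤k)))

  usingFrom-all : ∀ k → usingFrom k k ≡ D G k
  usingFrom-all k = count-all (usingFrom? k k) λ _ c k≤c → contradiction (toℕ<n c) (ℕₚ.≤⇒≯ k≤c)

  surjective-vanishes : ∀ k → n < k → usingFrom k 0 ≡ 0
  surjective-vanishes k n<k =
    count-none (usingFrom? k 0) λ a u → ℕₚ.<⇒≱ n<k (surjective⇒≤ (rep a) u)

  -- The labeling `id` gives every vertex its own colour; preserving it means fixing every vertex.
  surjective-positive : 0 < usingFrom n 0
  surjective-positive = count-some (usingFrom? n 0) {class id dist}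
    (usesFrom-resp {φ = id} {rep (class id dist)} (class-rep id dist) λ c _ → c , refl)
    where
    dist : Distinguishing G id
    dist π pr = pr

  D-zero : n ≥ 1 → D G 0 ≡ 0
  D-zero (s≤s _) = ¬Fin⇒≡0 λ a → no-label (rep a zero)
    where
    no-label : ¬ Fin 0
    no-label ()

  D-one : HasNonTrivialAutomorphism G → D G 1 ≡ 0
  D-one (π , nt) = ¬Fin⇒≡0 λ a → nt (rep-distinguishing a π λ v → only (rep a (apply G π v)) (rep a v))
    where
    only : (c c′ : Fin 1) → c ≡ c′
    only zero zero = refl

  -- Graphs without non-trivial automorphisms

  module _ (rigid : ¬ HasNonTrivialAutomorphism G) where

    rigid⇒trivial : ∀ π → IsTrivial G π
    rigid⇒trivial π = decidable-stable (all? λ v → apply G π v ≟ v) λ nt → rigid (π , nt)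

    rigid⇒≗ : ∀ {k} {φ ψ : Labeling n k} → Equivalent G φ ψ → φ ≗ ψ
    rigid⇒≗ {ψ = ψ} (π , e) v = trans (sym (e v)) (cong ψ (rigid⇒trivial π v))

    -- Every labeling is distinguishing and equivalence is pointwise equality, so coding
    -- representatives and taking classes of decoded labelings are injections in opposite
    -- directions.
    rigid⇒D≡k^n : ∀ k → D G k ≡ k ^ n
    rigid⇒D≡k^n k = ℕₚ.≤-antisym
      (injective⇒≤ {f = λ a → funToFin (rep a)} λ {a} {b} eq → rep-injective
        (≗⇒equivalent G λ v → trans (sym (finToFun-funToFin (rep a) v))
          (trans (cong (λ i → finToFun i v) eq) (finToFun-funToFin (rep b) v))))
      (injective⇒≤ {f = λ i → class (finToFun i) (dist i)} λ {i} {j} eq →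
        finToFun-injective {n} {k} i j λ v →
          trans (rigid⇒≗ {φ = finToFun i} {rep (class (finToFun i) (dist i))} (class-rep (finToFun i) (dist i)) v)
          (trans (cong (λ a → rep a v) eq)
                 (rigid⇒≗ {φ = rep (class (finToFun j) (dist j))} {finToFun j} (rep-class (finToFun j) (dist j)) v)))
      where
      dist : ∀ i → Distinguishing G (finToFun {k} {n} i)
      dist i π _ = rigid⇒trivial π

  -- The polynomial of a graph

  D-newton : ∀ k → D G k ≡ binomialSum (λ t → usingFrom t 0) k 0 n
  D-newton k = begin
    D G k                                    ≡⟨ usingFrom-all k ⟨
    usingFrom k k                            ≡⟨ cong (λ j → usingFrom j k) (ℕₚ.+-identityʳ k) ⟨
    -- In `usingFrom (i + t) i` the last `t` colours must occur. With `t` as row index the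
    -- recurrence becomes the difference relation; row 0 is `D G`, and column 0 counts the
    -- surjective classes.
    usingFrom (k + 0) k                      ≡⟨ newton-expansion (λ t i → usingFrom (i + t) i) step n surjective-vanishes k ⟩
    binomialSum (λ t → usingFrom t 0) k 0 n  ∎
    where
    open ≡-Reasoning
    step : ∀ t i → usingFrom (suc i + t) (suc i) ≡ usingFrom (i + suc t) i + usingFrom (i + t) i
    step t i = trans (usingFrom-recurrence (ℕₚ.m≤m+n i t))
      (cong (λ k → usingFrom k i + usingFrom (i + t) i) (sym (ℕₚ.+-suc i t)))

  distinguishingPoly : Polynomial
  distinguishingPoly = newtonPoly (λ t → usingFrom t 0) 0 n

  D≡eval : ∀ k → ℕ→ℚ (D G k) ≡ eval distinguishingPoly (ℕ→ℚ k)
  D≡eval k = begin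
    ℕ→ℚ (D G k)                             ≡⟨ cong ℕ→ℚ (D-newton k) ⟩
    ℕ→ℚ (binomialSum _ k 0 n)               ≡⟨ eval-newtonPoly (λ t → usingFrom t 0) k 0 n ⟨
    ℕ→ℚ (k C 0) ℚ.* value                   ≡⟨ cong (λ c → ℕ→ℚ c ℚ.* value) (nC0≡1 k) ⟩
    1ℚ ℚ.* value                            ≡⟨ ℚₚ.*-identityˡ value ⟩
    value                                   ∎
    where
    open ≡-Reasoning
    value : ℚ
    value = eval distinguishingPoly (ℕ→ℚ k)

  distinguishingPoly-degree : HasDegree distinguishingPoly n
  distinguishingPoly-degree = newtonPoly-degree _ 0 n
    (subst (λ t → 0 < usingFrom t 0) (sym (ℕₚ.+-identityʳ n)) surjective-positive)

  distinguishingPoly-coeffSum : HasNonTrivialAutomorphism G → coeffSum distinguishingPoly ≡ 0ℚ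
  distinguishingPoly-coeffSum nt =
    trans (coeffSum≡eval1 distinguishingPoly) (trans (sym (D≡eval 1)) (cong ℕ→ℚ (D-one nt)))

theorem13 : (n : ℕ) → n ≥ 1 → (G : Graph n) →
    Σ[ p ∈ Polynomial ] ( ((k : ℕ) → k ≥ 1 → ℕ→ℚ (D G k) ≡ eval p (ℕ→ℚ k))
    × HasDegree p n
    × coeff p 0 ≡ 0ℚ
    × (¬ HasNonTrivialAutomorphism G → (k : ℕ) → k ≥ 1 → D G k ≡ k ^ n)
    × (HasNonTrivialAutomorphism G → coeffSum p ≡ 0ℚ))
theorem13 (suc m) n≥1 G =
    distinguishingPoly G
  , (λ k _ → D≡eval G k)
  , distinguishingPoly-degree G
  -- The constant term is e(0) = `usingFrom 0 0`, which is `D G 0`: a vertex cannot be labeled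
  -- without colours.
  , newtonPoly-coeff0 _ m (trans (usingFrom-all G 0) (D-zero G n≥1))
  , (λ rigid k _ → rigid⇒D≡k^n G rigid k)
  , distinguishingPoly-coeffSum G
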